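{- Let $\lambda$ be an infinite cardinal, let $\Sigma$ be a $\lambda$-ary signature, and let $T$ be a theory in the language $\mathcal{L}_\lambda(\Sigma)$. Put $\alpha=\max\{\lambda,\omega_1\}$ and suppose that $\kappa$ is an $\alpha$-strongly compact cardinal. Let $\mathcal{D}$ be a $\kappa$-directed diagram of models of $T$, and suppose that $\mathcal{D}$ has a colimit in the category $\mathbf{Mod}\,T$ of models of $T$. Regard $\mathcal{D}$ also as a diagram in $\mathbf{Str}\,\Sigma$, and let $A$ be its colimit in $\mathbf{Str}\,\Sigma$. Then $A$ is a model of $T$. Hence $A$ is the colimit of $\mathcal{D}$ in $\mathbf{Mod}\,T$.
   Context: A signature $\Sigma$ is a set of function and relation symbols with associated (possibly infinite) arities; it is $\lambda$-ary if every symbol has arity strictly less than $\lambda$. A $\Sigma$-structure is a set $A$ with, for each $n$-ary relation symbol $R\in\Sigma$, a subset $R^A\subseteq A^n$ and, for each $n$-ary function symbol $f\in\Sigma$, a function $f^A:A^n\to A$ (here $n$ may be an infinite arity). $\mathbf{Str}\,\Sigma$ is the category of all $\Sigma$-structures with homomorphisms (maps preserving relations and commuting with functions) as morphisms. $\mathcal{L}_\lambda(\Sigma)$ is the infinitary language over $\Sigma$ in which conjunctions, disjunctions, and universal and existential quantifications of size less than $\lambda$ are allowed. A theory is a set of sentences of the language, and $\mathbf{Mod}\,T$ is the full subcategory of $\mathbf{Str}\,\Sigma$ whose objects are the models of $T$. A diagram is $\kappa$-directed if it is indexed by a poset in which every subset of cardinality less than $\kappa$ has an upper bound. (When $\Sigma$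 is $\kappa$-ary, all $\kappa$-directed colimits exist in $\mathbf{Str}\,\Sigma$ and are computed as direct limits on underlying sets.) For uncountable cardinals $\alpha\le\kappa$, $\kappa$ is $\alpha$-strongly compact if for every set $X$, every $\kappa$-complete filter on $X$ can be extended to an $\alpha$-complete ultrafilter on $X$. (Such $\kappa$ may be singular.) -}

-- "Set" is read in two ways.  Cardinals, arities, and the index sets of
-- conjunctions, quantifier blocks and filters are types; the carriers of
-- structures, where quotients matter, are setoids.

module Defs where

open import Level using (Level; _⊔_; suc)
open import Data.Empty.Polymorphic using (⊥; ⊥-elim)
open import Data.Nat.Base using (ℕ)
open import Data.Product.Base using (Σ; Σ-syntax; _×_; _,_; proj₁; proj₂)
open import Data.Sum.Base using (_⊎_; [_,_]′)
open import Data.Unit.Polymorphic using (⊤)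
open import Function.Base using (_∘_)
open import Function.Bundles using (_↣_; Func)
import Function.Construct.Composition as Comp
import Function.Construct.Identity as Id
open import Relation.Binary.Bundles using (Setoid; Poset)
open import Relation.Binary.Structures using (IsEquivalence)
open import Relation.Nullary.Negation.Core using (¬_)
open import Relation.Unary using (Pred; _∈_; _⊆_; _∩_; ∁; ⋂)

private
  variable
    a b c ℓ t o h e p : Level

------------------------------------------------------------------------
-- Cardinals
--
-- A cardinal is represented by any type of that cardinality.

infix 4 _≤ᶜ_ _<ᶜ_

_≤ᶜ_ : Set a → Set b → Set (a ⊔ b)
A ≤ᶜ B = A ↣ B

_<ᶜ_ : Set a → Set b → Set (a ⊔ b)
A <ᶜ B = (A ≤ᶜ B) × ¬ (B ≤ᶜ A)

Infinite : Set a → Set a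
Infinite A = ℕ ≤ᶜ A

Uncountable : Set a → Set a
Uncountable A = ℕ <ᶜ A

record Isω₁ (W : Set ℓ) : Set (suc ℓ) where
  field
    uncountable : Uncountable W
    least       : (B : Set ℓ) → Uncountable B → W ≤ᶜ B

record IsMax (A : Set a) (B : Set b) (M : Set c) : Set (a ⊔ b ⊔ c) where
  field
    upperˡ   : A ≤ᶜ M
    upperʳ   : B ≤ᶜ M
    attained : (M ≤ᶜ A) ⊎ (M ≤ᶜ B)

------------------------------------------------------------------------
-- Filters and strong compactness

record IsFilter {X : Set ℓ} (F : Pred (Pred X ℓ) ℓ) : Set (suc ℓ) where
  field
    whole  : (λ _ → ⊤) ∈ F
    proper : ¬ ((λ _ → ⊥) ∈ F)
    upward : ∀ {P Q : Pred X ℓ} → P ⊆ Q → P ∈ F → Q ∈ F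
    meet   : ∀ {P Q : Pred X ℓ} → P ∈ F → Q ∈ F → (P ∩ Q) ∈ F

record IsUltrafilter {X : Set ℓ} (F : Pred (Pred X ℓ) ℓ) : Set (suc ℓ) where
  field
    isFilter : IsFilter F
    ultra    : (P : Pred X ℓ) → (P ∈ F) ⊎ (∁ P ∈ F)

Complete : (κ : Set ℓ) {X : Set ℓ} → Pred (Pred X ℓ) ℓ → Set (suc ℓ)
Complete {ℓ} κ {X} F =
  (K : Set ℓ) → K <ᶜ κ → (P : K → Pred X ℓ) → (∀ k → P k ∈ F) → ⋂ K P ∈ F

record StronglyCompact (α κ : Set ℓ) : Set (suc ℓ) where
  field
    α-uncountable : Uncountable α
    α≤κ           : α ≤ᶜ κ
    extend        : (X : Set ℓ) (F : Pred (Pred X ℓ) ℓ) →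
                    IsFilter F → Complete κ F →
                    Σ[ V ∈ Pred (Pred X ℓ) ℓ ]
                      IsUltrafilter V × Complete α V × F ⊆ V

------------------------------------------------------------------------
-- Categories, full subcategories, and colimits of poset-indexed diagrams

record Category (o h e : Level) : Set (suc (o ⊔ h ⊔ e)) where
  infix  4 _≈_
  infixr 9 _∙_
  field
    Obj   : Set o
    Hom   : Obj → Obj → Set h
    _≈_   : ∀ {A B} → Hom A B → Hom A B → Set e
    id    : ∀ {A} → Hom A A
    _∙_   : ∀ {A B C} → Hom B C → Hom A B → Hom A C
    equiv : ∀ {A B} → IsEquivalence (_≈_ {A} {B})
    ∙-resp-≈  : ∀ {A B C} {f f′ : Hom B C} {g g′ : Hom A B} →
                f ≈ f′ → g ≈ g′ → f ∙ g ≈ f′ ∙ g′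
    identityˡ : ∀ {A B} {f : Hom A B} → id ∙ f ≈ f
    identityʳ : ∀ {A B} {f : Hom A B} → f ∙ id ≈ f
    assoc     : ∀ {A B C D} {f : Hom C D} {g : Hom B C} {k : Hom A B} →
                (f ∙ g) ∙ k ≈ f ∙ (g ∙ k)

FullSubcategory : (C : Category o h e) → Pred (Category.Obj C) p →
                  Category (o ⊔ p) h e
FullSubcategory C P = record
  { Obj       = Σ Obj P
  ; Hom       = λ A B → Hom (proj₁ A) (proj₁ B)
  ; _≈_       = _≈_
  ; id        = id
  ; _∙_       = _∙_
  ; equiv     = equiv
  ; ∙-resp-≈  = ∙-resp-≈
  ; identityˡ = identityˡ
  ; identityʳ = identityʳ
  ; assoc     = assoc
  }
  where open Category C

-- A subset of fewer than κ elements is given as a family indexed by a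
-- type K with |K| < κ.
Directed : (κ : Set ℓ) → Poset ℓ ℓ ℓ → Set (suc ℓ)
Directed {ℓ} κ I =
  (K : Set ℓ) → K <ᶜ κ → (f : K → Carrier) →
  Σ[ u ∈ Carrier ] (∀ k → f k ≤ u)
  where open Poset I

-- A functor from the poset I; D-irr says that the arrow i → j does not
-- depend on the proof of i ≤ j.
record Diagram (I : Poset ℓ ℓ ℓ) (C : Category o h e) :
               Set (ℓ ⊔ o ⊔ h ⊔ e) where
  open Poset I using (_≤_) renaming (Carrier to Ix; refl to ≤-refl; trans to ≤-trans)
  open Category C
  field
    D₀     : Ix → Obj
    D₁     : ∀ {i j} → i ≤ j → Hom (D₀ i) (D₀ j)
    D-irr  : ∀ {i j} (r s : i ≤ j) → D₁ r ≈ D₁ s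
    D-id   : ∀ {i} → D₁ (≤-refl {i}) ≈ id
    D-comp : ∀ {i j k} (r : i ≤ j) (s : j ≤ k) →
             D₁ (≤-trans r s) ≈ D₁ s ∙ D₁ r

module _ {I : Poset ℓ ℓ ℓ} {C : Category o h e} where
  open Poset I using (_≤_) renaming (Carrier to Ix)
  open Category C

  record Cocone (D : Diagram I C) : Set (ℓ ⊔ o ⊔ h ⊔ e) where
    open Diagram D
    field
      apex    : Obj
      leg     : ∀ i → Hom (D₀ i) apex
      commute : ∀ {i j} (r : i ≤ j) → leg j ∙ D₁ r ≈ leg i

  record IsColimit (D : Diagram I C) (L : Cocone D) :
                   Set (ℓ ⊔ o ⊔ h ⊔ e) where
    open Cocone
    field
      mediate : (M : Cocone D) → Hom (apex L) (apex M)
      factor  : (M : Cocone D) → ∀ i → mediate M ∙ leg L i ≈ leg M i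
      unique  : (M : Cocone D) (g : Hom (apex L) (apex M)) →
                (∀ i → g ∙ leg L i ≈ leg M i) → g ≈ mediate M

  record Colimit (D : Diagram I C) : Set (ℓ ⊔ o ⊔ h ⊔ e) where
    field
      cocone    : Cocone D
      isColimit : IsColimit D cocone
    open Cocone cocone public
    open IsColimit isColimit public

module _ {I : Poset ℓ ℓ ℓ} {C : Category o h e} {P : Pred (Category.Obj C) p} where

  include : Diagram I (FullSubcategory C P) → Diagram I C
  include D = record
    { D₀     = proj₁ ∘ D₀
    ; D₁     = D₁
    ; D-irr  = D-irr
    ; D-id   = D-id
    ; D-comp = D-comp
    }
    where open Diagram D

  restrict : (D : Diagram I (FullSubcategory C P)) (L : Cocone (include D)) →
             P (Cocone.apex L) → Cocone D
  restrict D L m = record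
    { apex    = apex , m
    ; leg     = leg
    ; commute = commute
    }
    where open Cocone L

------------------------------------------------------------------------
-- Signatures and structures

record Signature (ℓ : Level) : Set (suc ℓ) where
  field
    Fun   : Set ℓ
    Rel   : Set ℓ
    funAr : Fun → Set ℓ
    relAr : Rel → Set ℓ

record IsAry (lam : Set ℓ) (S : Signature ℓ) : Set ℓ where
  open Signature S
  field
    funAr< : ∀ f → funAr f <ᶜ lam
    relAr< : ∀ r → relAr r <ᶜ lam

module _ (S : Signature ℓ) where
  open Signature S

  record Structure : Set (suc ℓ) where
    field
      setoid : Setoid ℓ ℓ
    open Setoid setoid public
    field
      fun      : (f : Fun) → (funAr f → Carrier) → Carrier
      fun-cong : ∀ f {x y : funAr f → Carrier} →
                 (∀ n → x n ≈ y n) → fun f x ≈ fun f y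
      rel      : (r : Rel) → (relAr r → Carrier) → Set ℓ
      rel-resp : ∀ r {x y : relAr r → Carrier} →
                 (∀ n → x n ≈ y n) → rel r x → rel r y

  record Homomorphism (A B : Structure) : Set ℓ where
    private
      module A = Structure A
      module B = Structure B
    field
      func : Func A.setoid B.setoid
    open Func func public using (to; cong)
    field
      pres-fun : ∀ f (x : funAr f → A.Carrier) →
                 to (A.fun f x) B.≈ B.fun f (to ∘ x)
      pres-rel : ∀ r (x : relAr r → A.Carrier) →
                 A.rel r x → B.rel r (to ∘ x)

  open Homomorphism

  Str : Category (suc ℓ) ℓ ℓ
  Str = record
    { Obj       = Structure
    ; Hom       = Homomorphism
    ; _≈_       = λ {A} {B} f g → ∀ x → Structure._≈_ B (to f x) (to g x)
    ; id        = λ {A} → record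
      { func     = Id.function (Structure.setoid A)
      ; pres-fun = λ f x → Structure.refl A
      ; pres-rel = λ r x Rx → Rx
      }
    ; _∙_       = λ {A} {B} {C} g f → record
      { func     = Comp.function (func f) (func g)
      ; pres-fun = λ s x → Structure.trans C (cong g (pres-fun f s x))
                                             (pres-fun g s (to f ∘ x))
      ; pres-rel = λ r x Rx → pres-rel g r (to f ∘ x) (pres-rel f r x Rx)
      }
    ; equiv     = λ {A} {B} → record
      { refl  = λ x → Structure.refl B
      ; sym   = λ eq x → Structure.sym B (eq x)
      ; trans = λ eq₁ eq₂ x → Structure.trans B (eq₁ x) (eq₂ x)
      }
    ; ∙-resp-≈  = λ {A} {B} {C} {f} {f′} {g} {g′} f≈f′ g≈g′ x →
                  Structure.trans C (cong f (g≈g′ x)) (f≈f′ (to g′ x))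
    ; identityˡ = λ {A} {B} x → Structure.refl B
    ; identityʳ = λ {A} {B} x → Structure.refl B
    ; assoc     = λ {A} {B} {C} {D} x → Structure.refl D
    }

------------------------------------------------------------------------
-- The language of a signature S with conjunctions, disjunctions and
-- quantifier blocks of size less than lam

module _ (S : Signature ℓ) where
  open Signature S

  data Term (Γ : Set ℓ) : Set ℓ where
    var : Γ → Term Γ
    app : (f : Fun) → (funAr f → Term Γ) → Term Γ

  -- Formula Γ has its free variables in Γ; a quantifier binds a block K of
  -- further variables.
  data Formula (lam : Set ℓ) (Γ : Set ℓ) : Set (suc ℓ) where
    _≐_ : Term Γ → Term Γ → Formula lam Γ
    rel : (r : Rel) → (relAr r → Term Γ) → Formula lam Γ
    ∼_  : Formula lam Γ → Formula lam Γ
    ⋀   : (K : Set ℓ) → K <ᶜ lam → (K → Formula lam Γ) → Formula lam Γ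
    ⋁   : (K : Set ℓ) → K <ᶜ lam → (K → Formula lam Γ) → Formula lam Γ
    all : (K : Set ℓ) → K <ᶜ lam → Formula lam (Γ ⊎ K) → Formula lam Γ
    ex  : (K : Set ℓ) → K <ᶜ lam → Formula lam (Γ ⊎ K) → Formula lam Γ

  Sentence : Set ℓ → Set (suc ℓ)
  Sentence lam = Formula lam ⊥

  Theory : Set ℓ → (t : Level) → Set (suc ℓ ⊔ suc t)
  Theory lam t = Pred (Sentence lam) t

module _ {S : Signature ℓ} (A : Structure S) where
  open Structure A renaming (rel to relᴬ)

  eval : {Γ : Set ℓ} → (Γ → Carrier) → Term S Γ → Carrier
  eval ρ (var x)    = ρ x
  eval ρ (app f ts) = fun f (λ n → eval ρ (ts n))

  Sat : {lam Γ : Set ℓ} → (Γ → Carrier) → Formula S lam Γ → Set ℓ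
  Sat ρ (s ≐ u)     = eval ρ s ≈ eval ρ u
  Sat ρ (rel r ts)  = relᴬ r (λ n → eval ρ (ts n))
  Sat ρ (∼ φ)       = ¬ Sat ρ φ
  Sat ρ (⋀ K _ φ)   = (k : K) → Sat ρ (φ k)
  Sat ρ (⋁ K _ φ)   = Σ[ k ∈ K ] Sat ρ (φ k)
  Sat ρ (all K _ φ) = (x : K → Carrier) → Sat [ ρ , x ]′ φ
  Sat ρ (ex K _ φ)  = Σ[ x ∈ (K → Carrier) ] Sat [ ρ , x ]′ φ

infix 4 _⊨_

_⊨_ : {S : Signature ℓ} {lam : Set ℓ} →
      Structure S → Theory S lam t → Set (suc ℓ ⊔ t)
A ⊨ T = ∀ φ → φ ∈ T → Sat A ⊥-elim φ

Mod : {S : Signature ℓ} {lam : Set ℓ} → Theory S lam t →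
      Category (suc ℓ ⊔ t) ℓ ℓ
Mod {S = S} T = FullSubcategory (Str S) (_⊨ T)

{-# OPTIONS --safe #-}
-- Extend the filter of tails to an α-complete ultrafilter U on (essentially)
-- the index poset and let P be the ultraproduct of the diagram.  By Łoś, P is
-- a model, and it receives a cocone e.  Its ultrapower Q is a model too, and
-- there are two maps P → Q: the diagonal, and the ultraproduct of the legs
-- D i → P.  They agree at b exactly when b lies in the union E of the images
-- of the legs: if U-almost all i satisfy e i (b i) ≈ b, then some i does.
-- For the colimit B in Mod T, with mediating map g : B → P, the uniqueness of
-- maps B → Q makes both composites B → P → Q equal, so g lands in E.  As E is
-- a copy of the colimit A in Str, this gives a map B → A inverse to the
-- canonical map A → B.
module Submission where

open import Defs
open import Axiom.ExcludedMiddle using (ExcludedMiddle)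
open import Data.Empty using () renaming (⊥-elim to absurd)
open import Data.Empty.Polymorphic using (⊥; ⊥-elim)
open import Data.Nat.Base using (ℕ; zero; suc)
open import Data.Product.Base using (Σ; Σ-syntax; _×_; _,_; proj₁; proj₂)
open import Data.Sum.Base using (_⊎_; inj₁; inj₂; [_,_]′)
open import Data.Unit.Polymorphic using (tt)
open import Function.Base using (_∘_)
open import Function.Bundles using (Injection; mk↣)
open import Function.Construct.Composition using (_↣-∘_)
open import Level using (Level; Lift; lift; lower) renaming (suc to lsuc)
open import Relation.Binary.Bundles using (Poset)
open import Relation.Binary.PropositionalEquality using (refl; cong)
open import Relation.Nullary using (¬_; Dec; yes; no)
open import Relation.Unary using (Pred; _∈_; _⊆_; ∁; ⋂; ⋃)

private
  variable
    a b c ℓ t : Level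

-- Comparison of cardinals

<ᶜ-≤ᶜ-trans : {A : Set a} {B : Set b} {C : Set c} → A <ᶜ B → B ≤ᶜ C → A <ᶜ C
<ᶜ-≤ᶜ-trans (A≤B , B≰A) B≤C = B≤C ↣-∘ A≤B , λ C≤A → B≰A (C≤A ↣-∘ B≤C)

Lift-<ᶜ : {A : Set a} {B : Set b} → A <ᶜ B → Lift c A <ᶜ B
Lift-<ᶜ (A≤B , B≰A) =
  A≤B ↣-∘ lower↣ , λ B≤LA → B≰A (lower↣ ↣-∘ B≤LA)
  where lower↣ = mk↣ {to = lower} (cong lift)

⊥-<ᶜ : {B : Set b} → B → ⊥ {a} <ᶜ B
⊥-<ᶜ b = mk↣ {to = ⊥-elim} (λ { {()} }) , λ B≤⊥ → ⊥-elim (to B≤⊥ b)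
  where open Injection

-- Isomorphisms of structures

module _ {S : Signature ℓ} where
  open Signature S
  open Structure using (Carrier)
  open Homomorphism using (to; pres-fun; pres-rel) renaming (cong to to-cong)

  record Iso (A B : Structure S) : Set ℓ where
    private
      module A = Structure A
      module B = Structure B
    field
      forth      : Homomorphism S A B
      back       : Homomorphism S B A
      back∘forth : ∀ x → to back (to forth x) A.≈ x
      forth∘back : ∀ y → to forth (to back y) B.≈ y

  Iso-refl : {A : Structure S} → Iso A A
  Iso-refl {A} = record
    { forth      = Category.id (Str S) {A}
    ; back       = Category.id (Str S) {A}
    ; back∘forth = λ x → Structure.refl A
    ; forth∘back = λ x → Structure.refl A
    }

  Iso-sym : {A B : Structure S} → Iso A B → Iso B A
  Iso-sym h = record
    { forth = back ; back = forth ; back∘forth = forth∘back ; forth∘back = back∘forth }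
    where open Iso h

  eval-hom : {A B : Structure S} (h : Homomorphism S A B) {Γ : Set ℓ}
             {ρ : Γ → Carrier A} {σ : Γ → Carrier B} →
             (∀ v → Structure._≈_ B (to h (ρ v)) (σ v)) →
             ∀ u → Structure._≈_ B (to h (eval A ρ u)) (eval B σ u)
  eval-hom h ρ≈σ (var v)    = ρ≈σ v
  eval-hom {B = B} h ρ≈σ (app f us) =
    Structure.trans B (pres-fun h f _)
      (Structure.fun-cong B f (λ n → eval-hom h ρ≈σ (us n)))

  -- Negation reverses the direction and quantifiers need every element to be hit, so the induction
  -- runs over isomorphisms. Assignments are related pointwise up to `≈`, which survives extension
  -- by a block.
  Sat-iso : {A B : Structure S} (h : Iso A B) {lam Γ : Set ℓ}
            {ρ : Γ → Carrier A} {σ : Γ → Carrier B} →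
            (∀ v → Structure._≈_ B (to (Iso.forth h) (ρ v)) (σ v)) →
            (φ : Formula S lam Γ) → Sat A ρ φ → Sat B σ φ
  Sat-iso {A} {B} h ρ≈σ (s ≐ u) s≈u =
    B.trans (B.sym (eval-hom forth ρ≈σ s))
      (B.trans (to-cong forth s≈u) (eval-hom forth ρ≈σ u))
    where open Iso h
          module B = Structure B
  Sat-iso {A} {B} h ρ≈σ (rel r us) p =
    Structure.rel-resp B r (λ n → eval-hom forth ρ≈σ (us n)) (pres-rel forth r _ p)
    where open Iso h
  Sat-iso {A} {B} h ρ≈σ (∼ φ) ¬p q =
    ¬p (Sat-iso (Iso-sym h)
         (λ v → A.trans (to-cong back (B.sym (ρ≈σ v))) (back∘forth _)) φ q)
    where open Iso h
          module A = Structure A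
          module B = Structure B
  Sat-iso h ρ≈σ (⋀ K _ φ) p = λ k → Sat-iso h ρ≈σ (φ k) (p k)
  Sat-iso h ρ≈σ (⋁ K _ φ) (k , p) = k , Sat-iso h ρ≈σ (φ k) p
  Sat-iso h ρ≈σ (all K _ φ) p = λ y →
    Sat-iso h (λ { (inj₁ v) → ρ≈σ v ; (inj₂ k) → forth∘back (y k) }) φ
      (p (to back ∘ y))
    where open Iso h
  Sat-iso {B = B} h ρ≈σ (ex K _ φ) (x , p) = to forth ∘ x ,
    Sat-iso h (λ { (inj₁ v) → ρ≈σ v ; (inj₂ k) → Structure.refl B }) φ p
    where open Iso h

  Sat-resp : (A : Structure S) {lam Γ : Set ℓ} {ρ σ : Γ → Carrier A} →
             (∀ v → Structure._≈_ A (ρ v) (σ v)) →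
             (φ : Formula S lam Γ) → Sat A ρ φ → Sat A σ φ
  Sat-resp A = Sat-iso (Iso-refl {A})

-- Ultrafilters and ultraproducts

module Ultrafilter (em : ExcludedMiddle ℓ) {X : Set ℓ} (U : Pred (Pred X ℓ) ℓ)
                   (isUltrafilter : IsUltrafilter U) where

  open IsUltrafilter isUltrafilter
  open IsFilter isFilter public

  Closed : Set ℓ → Set (lsuc ℓ)
  Closed K = (P : K → Pred X ℓ) → (∀ k → P k ∈ U) → ⋂ K P ∈ U

  inhabited : {P : Pred X ℓ} → P ∈ U → Σ X P
  inhabited {P} p with em {Σ X P}
  ... | yes x = x
  ... | no ¬x = absurd (proper (upward (λ {x} px → absurd (¬x (x , px))) p))

  always : {P : Pred X ℓ} → (∀ x → P x) → P ∈ U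
  always p = upward (λ {x} _ → p x) whole

  ∁-closed : {P : Pred X ℓ} → ¬ P ∈ U → ∁ P ∈ U
  ∁-closed {P} ¬p with ultra P
  ... | inj₁ p = absurd (¬p p)
  ... | inj₂ q = q

  disjoint : {P : Pred X ℓ} → P ∈ U → ¬ ∁ P ∈ U
  disjoint p q with inhabited (meet p q)
  ... | _ , px , ¬px = ¬px px

  -- If no `P k` were in `U`, all complements would be, hence also their intersection, which is
  -- disjoint from the union.
  ⋃-prime : {K : Set ℓ} → Closed K → (P : K → Pred X ℓ) →
            ⋃ K P ∈ U → Σ[ k ∈ K ] P k ∈ U
  ⋃-prime {K} closed P p with em {Σ[ k ∈ K ] P k ∈ U}
  ... | yes q = q
  ... | no ¬q = absurd (disjoint p (upward (λ { none (k , pk) → none k pk })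
                  (closed (∁ ∘ P) (λ k → ∁-closed (λ pk → ¬q (k , pk))))))

  -- The structures have to be all empty or all inhabited: an ultraproduct
  -- with empty factors may be empty although almost all factors are not.
  choose : (M : X → Set ℓ) → (∀ x y → M y → M x) →
           (K : Set ℓ) (P : ∀ x → Pred (K → M x) ℓ) →
           (λ x → Σ (K → M x) (P x)) ∈ U →
           Σ[ w ∈ (K → ∀ x → M x) ] (λ x → P x (λ k → w k x)) ∈ U
  choose M default K P p = (λ k x → pick x em k) , upward (λ {x} → correct em) p
    where
    witness = inhabited p

    pick : ∀ x → Dec (Σ (K → M x) (P x)) → K → M x
    pick x (yes (w , _)) = w
    -- Off the given set the value is arbitrary: each entry is moved here from one fixed index that
    -- has a witness.
    pick x (no _) k      = default x (proj₁ witness) (proj₁ (proj₂ witness) k)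

    correct : ∀ {x} (d : Dec (Σ (K → M x) (P x))) → Σ (K → M x) (P x) → P x (pick x d)
    correct (yes (_ , pw)) _ = pw
    correct (no ¬w) w        = absurd (¬w w)

  module Ultraproduct {S : Signature ℓ}
                      (closedFun : ∀ f → Closed (Signature.funAr S f))
                      (closedRel : ∀ r → Closed (Signature.relAr S r)) where
    open Structure using (Carrier)
    open Homomorphism using (to; pres-fun; pres-rel) renaming (cong to to-cong)

    -- Equality is almost-everywhere equality. Closure of `U` under intersections over arities makes
    -- functions and relations respect it.
    ∏ : (X → Structure S) → Structure S
    ∏ M = record
      { setoid   = record
        { Carrier       = ∀ x → M.Carrier x
        ; _≈_           = λ f g → U (λ x → M._≈_ x (f x) (g x))
        ; isEquivalence = record
          { refl  = always (λ x → M.refl x)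
          ; sym   = upward (λ {x} → M.sym x)
          ; trans = λ p q → upward (λ {x} (p , q) → M.trans x p q) (meet p q)
          }
        }
      ; fun      = λ s fs x → M.fun x s (λ n → fs n x)
      ; fun-cong = λ s eqs → upward (λ {x} → M.fun-cong x s) (closedFun s _ eqs)
      ; rel      = λ r fs → U (λ x → M.rel x r (λ n → fs n x))
      ; rel-resp = λ r eqs p → upward (λ {x} (eq , q) → M.rel-resp x r eq q)
                                 (meet (closedRel r _ eqs) p)
      }
      where module M x = Structure (M x)

    ∏-map : {M N : X → Structure S} → (∀ x → Homomorphism S (M x) (N x)) →
            Homomorphism S (∏ M) (∏ N)
    ∏-map h = record
      { func     = record
        { to   = λ f x → to (h x) (f x)
        ; cong = upward (λ {x} → to-cong (h x))
        }
      ; pres-fun = λ s fs → always (λ x → pres-fun (h x) s _)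
      ; pres-rel = λ r fs → upward (λ {x} → pres-rel (h x) r _)
      }

    diagonal : (N : Structure S) → Homomorphism S N (∏ (λ _ → N))
    diagonal N = record
      { func     = record
        { to   = λ y _ → y
        ; cong = λ eq → always (λ _ → eq)
        }
      ; pres-fun = λ s ys → always (λ _ → Structure.refl N)
      ; pres-rel = λ r ys p → always (λ _ → p)
      }

    eval-∏ : (M : X → Structure S) {Γ : Set ℓ} (ρ : Γ → Carrier (∏ M)) (u : Term S Γ) →
             Structure._≈_ (∏ M) (eval (∏ M) ρ u) (λ x → eval (M x) (λ v → ρ v x) u)
    eval-∏ M ρ (var v)    = Structure.refl (∏ M) {ρ v}
    eval-∏ M ρ (app f us) =
      Structure.fun-cong (∏ M) f
        {y = λ n x → eval (M x) (λ v → ρ v x) (us n)} (λ n → eval-∏ M ρ (us n))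

    module Łoś {lam : Set ℓ} (closed : ∀ {K : Set ℓ} → K <ᶜ lam → Closed K)
               (M : X → Structure S)
               (default : ∀ x y → Carrier (M y) → Carrier (M x)) where

      private
        module M x = Structure (M x)
        module P = Structure (∏ M)

      Sat-at : {Γ : Set ℓ} → (Γ → P.Carrier) → Formula S lam Γ → Pred X ℓ
      Sat-at ρ φ x = Sat (M x) (λ v → ρ v x) φ

      at-extend : {Γ K : Set ℓ} (ρ : Γ → P.Carrier) (w : K → P.Carrier) → ∀ x v →
                  M._≈_ x ([ ρ , w ]′ v x) ([ (λ v → ρ v x) , (λ k → w k x) ]′ v)
      at-extend ρ w x (inj₁ v) = M.refl x
      at-extend ρ w x (inj₂ k) = M.refl x

      -- Induction on the formula; negation makes the two directions mutually recursive.
      -- Conjunctions rest on `closed`, disjunctions on `⋃-prime`, and witnesses for quantifiers are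
      -- assembled by `choose`.
      Łoś⇒ : {Γ : Set ℓ} (ρ : Γ → P.Carrier) (φ : Formula S lam Γ) →
             Sat (∏ M) ρ φ → Sat-at ρ φ ∈ U
      Łoś⇐ : {Γ : Set ℓ} (ρ : Γ → P.Carrier) (φ : Formula S lam Γ) →
             Sat-at ρ φ ∈ U → Sat (∏ M) ρ φ

      Łoś⇒ ρ (s ≐ u) p =
        upward (λ {x} (p , q , r) → M.trans x (M.sym x p) (M.trans x q r))
          (meet (eval-∏ M ρ s) (meet p (eval-∏ M ρ u)))
      Łoś⇒ ρ (rel r us) p =
        P.rel-resp r {y = λ n x → eval (M x) (λ v → ρ v x) (us n)}
          (λ n → eval-∏ M ρ (us n)) p
      Łoś⇒ ρ (∼ φ) ¬p = ∁-closed (λ q → ¬p (Łoś⇐ ρ φ q))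
      Łoś⇒ ρ (⋀ K K< φ) p = closed K< _ (λ k → Łoś⇒ ρ (φ k) (p k))
      Łoś⇒ ρ (⋁ K K< φ) (k , p) = upward (λ q → k , q) (Łoś⇒ ρ (φ k) p)
      -- Otherwise counterexamples exist almost everywhere; `choose` collects them into one block
      -- `w` in the product, which contradicts `p w`.
      Łoś⇒ ρ (all K K< φ) p with em {Sat-at ρ (all K K< φ) ∈ U}
      ... | yes q = q
      ... | no ¬q with choose M.Carrier default K
                         (λ x w → ¬ Sat (M x) [ (λ v → ρ v x) , w ]′ φ)
                         (upward (λ {x} ¬all → counterexample x ¬all) (∁-closed ¬q))
        where
        counterexample : ∀ x → ¬ Sat-at ρ (all K K< φ) x →
                         Σ[ w ∈ (K → M.Carrier x) ] ¬ Sat (M x) [ (λ v → ρ v x) , w ]′ φ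
        counterexample x ¬all
          with em {Σ[ w ∈ (K → M.Carrier x) ] ¬ Sat (M x) [ (λ v → ρ v x) , w ]′ φ}
        ... | yes c = c
        ... | no ¬c = absurd (¬all stable)
          where
          stable : Sat-at ρ (all K K< φ) x
          stable w with em {Sat (M x) [ (λ v → ρ v x) , w ]′ φ}
          ... | yes s = s
          ... | no ¬s = absurd (¬c (w , ¬s))
      ...   | w , fails =
        absurd (disjoint
          (upward (λ {x} → Sat-resp (M x) (at-extend ρ w x) φ) (Łoś⇒ [ ρ , w ]′ φ (p w)))
          fails)
      Łoś⇒ ρ (ex K K< φ) (w , p) =
        upward (λ {x} q → (λ k → w k x) , Sat-resp (M x) (at-extend ρ w x) φ q)
          (Łoś⇒ [ ρ , w ]′ φ p)

      Łoś⇐ ρ (s ≐ u) p =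
        upward (λ {x} (p , q , r) → M.trans x p (M.trans x q (M.sym x r)))
          (meet (eval-∏ M ρ s) (meet p (eval-∏ M ρ u)))
      Łoś⇐ ρ (rel r us) p =
        P.rel-resp r {x = λ n x → eval (M x) (λ v → ρ v x) (us n)}
          (λ n → P.sym {eval (∏ M) ρ (us n)} (eval-∏ M ρ (us n))) p
      Łoś⇐ ρ (∼ φ) ¬p q = disjoint (Łoś⇒ ρ φ q) ¬p
      Łoś⇐ ρ (⋀ K K< φ) p = λ k → Łoś⇐ ρ (φ k) (upward (λ q → q k) p)
      Łoś⇐ ρ (⋁ K K< φ) p with ⋃-prime (closed K<) (λ k → Sat-at ρ (φ k)) p
      ... | k , q = k , Łoś⇐ ρ (φ k) q
      Łoś⇐ ρ (all K K< φ) p = λ w → Łoś⇐ [ ρ , w ]′ φ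
        (upward (λ {x} q → Sat-resp (M x) (λ v → M.sym x (at-extend ρ w x v)) φ
                             (q (λ k → w k x))) p)
      Łoś⇐ ρ (ex K K< φ) p
        with choose M.Carrier default K (λ x w → Sat (M x) [ (λ v → ρ v x) , w ]′ φ) p
      ... | w , q = w , Łoś⇐ [ ρ , w ]′ φ
        (upward (λ {x} → Sat-resp (M x) (λ v → M.sym x (at-extend ρ w x v)) φ) q)

      ∏-⊨ : {T : Theory S lam t} → (∀ x → M x ⊨ T) → ∏ M ⊨ T
      ∏-⊨ models φ φ∈T =
        Łoś⇐ ⊥-elim φ (always (λ x → Sat-resp (M x) (λ ()) φ (models x φ φ∈T)))

-- The ultraproduct of a directed diagram

module DirectedDiagram (em : ExcludedMiddle ℓ) {κ : Set ℓ} (ℕ<κ : ℕ <ᶜ κ)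
                       {I : Poset ℓ ℓ ℓ} (directed : Directed κ I)
                       {S : Signature ℓ} (D : Diagram I (Str S)) where

  open Poset I using (_≤_) renaming (Carrier to Ix; trans to ≤-trans)
  open Diagram D
  open Signature S
  open Structure using (Carrier)
  open Homomorphism using (to; pres-fun; pres-rel) renaming (cong to to-cong)

  private
    module D i = Structure (D₀ i)

  -- Not necessarily a least element: a bound of the empty family, which shows that some index
  -- exists.
  bottom : Ix
  bottom = proj₁ (directed ⊥ (⊥-<ᶜ (Injection.to (proj₁ ℕ<κ) 0)) ⊥-elim)

  join : ∀ i j → Σ[ u ∈ Ix ] i ≤ u × j ≤ u
  join i j with directed (Lift ℓ ℕ) (Lift-<ᶜ ℕ<κ)
                  -- The pair is listed as the sequence `i`, `j`, `j`, and so on, to use `ℕ<κ`.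
                  (λ { (lift zero) → i ; (lift (suc _)) → j })
  ... | u , ≤u = u , ≤u (lift 0) , ≤u (lift 1)

  Point : Set ℓ
  Point = Σ[ i ∈ Ix ] D.Carrier i

  -- The indices j such that D j is inhabited unless the whole diagram is
  -- empty, so that D is homogeneous over X in the sense required by choose.
  X : Set ℓ
  X = Σ[ j ∈ Ix ] (Point → D.Carrier j)

  M : X → Structure S
  M x = D₀ (proj₁ x)

  private
    module M x = Structure (M x)

  M-default : ∀ x y → M.Carrier y → M.Carrier x
  M-default (_ , d) (j , _) a = d (j , a)

  -- Makes every tail over `X` nonempty. If the diagram has no points, the required function is
  -- vacuous; otherwise one point is moved to a stage beyond `i` and the function is constant.
  cofinal : ∀ i → Σ[ x ∈ X ] i ≤ proj₁ x
  cofinal i with em {Point}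
  ... | no ¬pt = (i , λ pt → absurd (¬pt pt)) , Poset.refl I
  ... | yes (j , a) with join i j
  ...   | u , i≤u , j≤u = (u , λ _ → to (D₁ j≤u) a) , i≤u

  -- The filter of tails

  Tail : Ix → Pred X ℓ
  Tail i x = i ≤ proj₁ x

  Tails : Pred (Pred X ℓ) ℓ
  Tails P = Σ[ i ∈ Ix ] (∀ x → x ∈ Tail i → x ∈ P)

  Tails-isFilter : IsFilter Tails
  Tails-isFilter = record
    { whole  = bottom , λ _ _ → tt
    ; proper = λ (i , empty) → ⊥-elim (empty (proj₁ (cofinal i)) (proj₂ (cofinal i)))
    ; upward = λ P⊆Q (i , p) → i , λ x i≤x → P⊆Q (p x i≤x)
    ; meet   = λ (i , p) (j , q) → let (u , i≤u , j≤u) = join i j in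
                 u , λ x u≤x → p x (≤-trans i≤u u≤x) , q x (≤-trans j≤u u≤x)
    }

  Tails-complete : Complete κ Tails
  Tails-complete K K<κ P p with directed K K<κ (proj₁ ∘ p)
  ... | u , ≤u = u , λ x u≤x k → proj₂ (p k) x (≤-trans (≤u k) u≤x)

  module Image {lam : Set ℓ} (ary : IsAry lam S) (lam≤κ : lam ≤ᶜ κ)
               (U : Pred (Pred X ℓ) ℓ) (isUltrafilter : IsUltrafilter U)
               (closed : ∀ {K : Set ℓ} → K <ᶜ lam → Ultrafilter.Closed em U isUltrafilter K)
               (Tails⊆U : Tails ⊆ U) where

    open IsAry ary
    open Ultrafilter em U isUltrafilter hiding (Closed)
    open Ultraproduct {S} (λ f → closed (funAr< f)) (λ r → closed (relAr< r)) public

    P Q : Structure S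
    P = ∏ M
    Q = ∏ (λ _ → P)

    private
      module P = Structure P
      module Q = Structure Q

    -- The cocone of germs on the ultraproduct

    Tail∈U : ∀ i → Tail i ∈ U
    Tail∈U i = Tails⊆U (i , λ _ i≤x → i≤x)

    -- Elements of `P` are total families, so a value is needed off the tail of `i` too; the second
    -- component of `x` supplies one. Tails lie in `U`, so its choice is invisible in `P`.
    transport : ∀ i → D.Carrier i → ∀ x → Dec (i ≤ proj₁ x) → M.Carrier x
    transport i a x (yes i≤x) = to (D₁ i≤x) a
    transport i a x (no _)    = proj₂ x (i , a)

    germ : ∀ i → D.Carrier i → P.Carrier
    germ i a x = transport i a x em

    germ-at : ∀ i a x (i≤x : i ≤ proj₁ x) → M._≈_ x (germ i a x) (to (D₁ i≤x) a)
    germ-at i a x i≤x with em {i ≤ proj₁ x}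
    ... | yes i≤x′ = D-irr i≤x′ i≤x a
    ... | no i≰x   = absurd (i≰x i≤x)

    leg : ∀ i → Homomorphism S (D₀ i) P
    leg i = record
      { func     = record
        { to   = germ i
        ; cong = λ {a} {b} a≈b → upward
            (λ {x} i≤x → M.trans x (germ-at i a x i≤x)
              (M.trans x (to-cong (D₁ i≤x) a≈b) (M.sym x (germ-at i b x i≤x))))
            (Tail∈U i)
        }
      ; pres-fun = λ f as → upward
          (λ {x} i≤x → M.trans x (germ-at i _ x i≤x)
            (M.trans x (pres-fun (D₁ i≤x) f as)
              (M.fun-cong x f (λ n → M.sym x (germ-at i (as n) x i≤x)))))
          (Tail∈U i)
      ; pres-rel = λ r as p → upward
          (λ {x} i≤x → M.rel-resp x r (λ n → M.sym x (germ-at i (as n) x i≤x))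
            (pres-rel (D₁ i≤x) r as p))
          (Tail∈U i)
      }

    leg-commute : ∀ {i j} (i≤j : i ≤ j) a → germ j (to (D₁ i≤j) a) P.≈ germ i a
    leg-commute {i} {j} i≤j a = upward
      (λ {x} j≤x → M.trans x (germ-at j _ x j≤x)
        (M.trans x (M.sym x (D-comp i≤j j≤x a))
          (M.sym x (germ-at i a x (≤-trans i≤j j≤x)))))
      (Tail∈U j)

    P-cocone : Cocone D
    P-cocone = record { apex = P ; leg = leg ; commute = leg-commute }

    -- Two maps from the ultraproduct to its ultrapower

    germwise : Homomorphism S P Q
    germwise = ∏-map (λ x → leg (proj₁ x))

    -- On the tail of `i`, entry `x` of `germ i a` is `a` moved to the stage of `x`, and moving a
    -- point along the diagram preserves its germ.
    equalize : ∀ i a → to germwise (germ i a) Q.≈ to (diagonal P) (germ i a)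
    equalize i a = upward
      (λ {x} i≤x →
        P.trans {germ (proj₁ x) (germ i a x)} {germ (proj₁ x) (to (D₁ i≤x) a)} {germ i a}
          (to-cong (leg (proj₁ x)) (germ-at i a x i≤x))
          (leg-commute i≤x a))
      (Tail∈U i)

    germOf : Point → P.Carrier
    germOf (i , a) = germ i a

    -- A set in `U` is nonempty, and a single `x` at which the two maps agree exhibits `f` as the
    -- germ of its own entry `f x`.
    equalizer⊆germs : ∀ f → to germwise f Q.≈ to (diagonal P) f →
                      Σ[ pt ∈ Point ] germOf pt P.≈ f
    equalizer⊆germs f eq with inhabited eq
    ... | x , eqₓ = (proj₁ x , f x) , eqₓ

    -- The union of the images of the legs

    lift-to : ∀ {K : Set ℓ} (pts : K → Point) u (≤u : ∀ k → proj₁ (pts k) ≤ u) →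
              K → D.Carrier u
    lift-to pts u ≤u k = to (D₁ (≤u k)) (proj₂ (pts k))

    germ-lift-to : ∀ {K : Set ℓ} (pts : K → Point) u (≤u : ∀ k → proj₁ (pts k) ≤ u) k →
                   germ u (lift-to pts u ≤u k) P.≈ germOf (pts k)
    germ-lift-to pts u ≤u k = leg-commute (≤u k) (proj₂ (pts k))

    bound : ∀ {K : Set ℓ} → K <ᶜ lam → (pts : K → Point) →
            Σ[ u ∈ Ix ] (∀ k → proj₁ (pts k) ≤ u)
    bound K<lam pts = directed _ (<ᶜ-≤ᶜ-trans K<lam lam≤κ) (proj₁ ∘ pts)

    -- The symbol is applied at a common stage of its arguments. By `germ-fun` this is the operation
    -- of `P` on germs, so the stage does not matter.
    E-fun : ∀ f → (funAr f → Point) → Point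
    E-fun f pts = let (u , ≤u) = bound (funAr< f) pts in
      u , D.fun u f (lift-to pts u ≤u)

    germ-fun : ∀ f pts → germOf (E-fun f pts) P.≈ P.fun f (germOf ∘ pts)
    germ-fun f pts = let (u , ≤u) = bound (funAr< f) pts in
      P.trans {germOf (E-fun f pts)} {P.fun f (λ n → germ u (lift-to pts u ≤u n))}
        (pres-fun (leg u) f (lift-to pts u ≤u))
        (P.fun-cong f {y = germOf ∘ pts} (germ-lift-to pts u ≤u))

    -- Elements are points of the diagram rather than of `P`, so each carries a stage at which it
    -- lives; equality and relations are pulled back along `germOf`.
    E : Structure S
    E = record
      { setoid   = record
        { Carrier       = Point
        ; _≈_           = λ p q → germOf p P.≈ germOf q
        ; isEquivalence = record
          { refl  = λ {p} → P.refl {germOf p}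
          ; sym   = λ {p} {q} → P.sym {germOf p} {germOf q}
          ; trans = λ {p} {q} {r} → P.trans {germOf p} {germOf q} {germOf r}
          }
        }
      ; fun      = E-fun
      ; fun-cong = λ f {ps} {qs} eqs →
          P.trans {germOf (E-fun f ps)} {P.fun f (germOf ∘ ps)} (germ-fun f ps)
            (P.trans {P.fun f (germOf ∘ ps)} {P.fun f (germOf ∘ qs)}
              (P.fun-cong f {germOf ∘ ps} {germOf ∘ qs} eqs)
              (P.sym {germOf (E-fun f qs)} (germ-fun f qs)))
      ; rel      = λ r pts → P.rel r (germOf ∘ pts)
      ; rel-resp = λ r {ps} {qs} → P.rel-resp r {germOf ∘ ps} {germOf ∘ qs}
      }

    private
      module E = Structure E

    corestrict : {B : Structure S} (g : Homomorphism S B P) →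
                 (∀ b → Σ[ pt ∈ Point ] germOf pt P.≈ to g b) → Homomorphism S B E
    corestrict {B} g image = record
      { func     = record
        { to   = proj₁ ∘ image
        ; cong = λ {b} {c} b≈c →
            P.trans {germOf (proj₁ (image b))} {to g b} (proj₂ (image b))
              (P.trans {to g b} {to g c} (to-cong g b≈c)
                (P.sym {germOf (proj₁ (image c))} (proj₂ (image c))))
        }
      ; pres-fun = λ f bs →
          P.trans {germOf (proj₁ (image _))} {to g (Structure.fun B f bs)}
            (proj₂ (image _))
            (P.trans {to g (Structure.fun B f bs)} {P.fun f (to g ∘ bs)} (pres-fun g f bs)
              (P.trans {P.fun f (to g ∘ bs)} {P.fun f (germOf ∘ proj₁ ∘ image ∘ bs)}
                (P.fun-cong f {to g ∘ bs}
                  (λ n → P.sym {germOf (proj₁ (image (bs n)))} (proj₂ (image (bs n)))))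
                (P.sym {germOf (E-fun f (proj₁ ∘ image ∘ bs))} (germ-fun f _))))
      ; pres-rel = λ r bs p →
          P.rel-resp r {to g ∘ bs}
            (λ n → P.sym {germOf (proj₁ (image (bs n)))} (proj₂ (image (bs n))))
            (pres-rel g r bs p)
      }

    -- Maps from the union to arbitrary cocones

    module _ (L : Cocone D) where
      private
        module L = Cocone L
        module C = Structure L.apex

      value : Point → C.Carrier
      value (i , a) = to (L.leg i) a

      value-at : ∀ p x (p≤x : proj₁ p ≤ proj₁ x) →
                 value p C.≈ to (L.leg (proj₁ x)) (germOf p x)
      value-at (i , a) x i≤x = C.trans (C.sym (L.commute i≤x a))
        (to-cong (L.leg (proj₁ x)) (M.sym x (germ-at i a x i≤x)))

      -- Equal germs agree on a set in `U`. It meets both tails in some `x`, and at that stage the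
      -- two points are already equal in the diagram.
      value-cong : ∀ {p q} → p E.≈ q → value p C.≈ value q
      value-cong {p} {q} eq with inhabited (meet eq (meet (Tail∈U _) (Tail∈U _)))
      ... | x , eqₓ , p≤x , q≤x = C.trans (value-at p x p≤x)
        (C.trans (to-cong (L.leg (proj₁ x)) eqₓ) (C.sym (value-at q x q≤x)))

      value-hom : Homomorphism S E L.apex
      value-hom = record
        { func     = record { to = value ; cong = λ {p} {q} → value-cong {p} {q} }
        ; pres-fun = λ f pts → let (u , ≤u) = bound (funAr< f) pts in
            C.trans (pres-fun (L.leg u) f _)
              (C.fun-cong f (λ n → L.commute (≤u n) (proj₂ (pts n))))
        ; pres-rel = value-rel
        }
        where
        -- Completeness over the arity intersects the tails of all arguments, so the relation holds
        -- at one actual stage beyond all of them, and a leg of `L` carries it over.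
        value-rel : ∀ r pts → E.rel r pts → C.rel r (value ∘ pts)
        value-rel r pts p with inhabited (meet p
                                 (closed (relAr< r) _ (λ n → Tail∈U (proj₁ (pts n)))))
        ... | x , pₓ , ≤x =
          C.rel-resp r (λ n → C.sym (value-at (pts n) x (≤x n)))
            (pres-rel (L.leg (proj₁ x)) r _ pₓ)

-- Colimits in `Mod T` and in `Str S`

module _ {S : Signature ℓ} {lam : Set ℓ} {T : Theory S lam t} {I : Poset ℓ ℓ ℓ}
         (D : Diagram I (Mod T)) (A : Colimit (include D)) where
  open Category (Str S) using (_∙_; _≈_)
  private
    module A = Colimit A

  includeCocone : Cocone D → Cocone (include D)
  includeCocone L = record { apex = proj₁ apex ; leg = leg ; commute = commute }
    where open Cocone L

  restrict-isColimit : (m : A.apex ⊨ T) → IsColimit D (restrict D A.cocone m)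
  restrict-isColimit m = record
    { mediate = λ L → A.mediate (includeCocone L)
    ; factor  = λ L → A.factor (includeCocone L)
    ; unique  = λ L → A.unique (includeCocone L)
    }

  -- The inverse `h` exists because `B` is also a cocone in `Str S`. Both composites fix the legs,
  -- so uniqueness, in `Mod T` for `B` and in `Str S` for `A`, makes them identities.
  comparison-iso : (B : Colimit D) (r : Homomorphism S (proj₁ (Colimit.apex B)) A.apex) →
                   (∀ i → _≈_ {_} {A.apex} (r ∙ Colimit.leg B i) (A.leg i)) →
                   Iso (proj₁ (Colimit.apex B)) A.apex
  comparison-iso B r r-leg = record
    { forth      = r
    ; back       = h
    ; back∘forth = λ b → B.trans (B.unique B.cocone (h ∙ r) hr-leg b)
                           (B.sym (B.unique B.cocone (Category.id (Str S)) (λ i x → B.refl) b))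
    ; forth∘back = λ a → A′.trans (A.unique A.cocone (r ∙ h) rh-leg a)
                           (A′.sym (A.unique A.cocone (Category.id (Str S)) (λ i x → A′.refl) a))
    }
    where
    module B where
      open Colimit B public
      open Structure (proj₁ apex) public using (refl; sym; trans)
    module A′ = Structure A.apex
    open Homomorphism using () renaming (cong to to-cong)

    h : Homomorphism S A.apex (proj₁ B.apex)
    h = A.mediate (includeCocone B.cocone)

    hr-leg : ∀ i → _≈_ {_} {proj₁ B.apex} ((h ∙ r) ∙ B.leg i) (B.leg i)
    hr-leg i x = B.trans (to-cong h (r-leg i x)) (A.factor (includeCocone B.cocone) i x)

    rh-leg : ∀ i → _≈_ {_} {A.apex} ((r ∙ h) ∙ A.leg i) (A.leg i)
    rh-leg i x = A′.trans (to-cong r (A.factor (includeCocone B.cocone) i x)) (r-leg i x)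

theorem10 : {ℓ t : Level} → ExcludedMiddle ℓ →
    (lam : Set ℓ) → Infinite lam →
    (S : Signature ℓ) → IsAry lam S →
    (T : Theory S lam t) →
    (ω₁ α κ : Set ℓ) → Isω₁ ω₁ → IsMax lam ω₁ α →
    StronglyCompact α κ →
    (I : Poset ℓ ℓ ℓ) → Directed κ I →
    (D : Diagram I (Mod T)) → Colimit D →
    (A : Colimit (include D)) →
    Σ[ m ∈ (Colimit.apex A ⊨ T) ] IsColimit D (restrict D (Colimit.cocone A) m)
theorem10 {ℓ} em lam _ S ary T ω₁ α κ _ max compact I directed D B A =
  A⊨T , restrict-isColimit D A A⊨T
  where
  open StronglyCompact compact
  open IsMax max
  open Homomorphism using (to) renaming (cong to to-cong)
  open DirectedDiagram em (<ᶜ-≤ᶜ-trans α-uncountable α≤κ) directed (include D)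
  module A = Colimit A
  module A′ = Structure A.apex
  module B = Colimit B

  U : Pred (Pred X ℓ) ℓ
  U = proj₁ (extend X Tails Tails-isFilter Tails-complete)

  isUltrafilter : IsUltrafilter U
  isUltrafilter = proj₁ (proj₂ (extend X Tails Tails-isFilter Tails-complete))

  closed : ∀ {K : Set ℓ} → K <ᶜ lam → Ultrafilter.Closed em U isUltrafilter K
  closed K<lam = proj₁ (proj₂ (proj₂ (extend X Tails Tails-isFilter Tails-complete)))
    _ (<ᶜ-≤ᶜ-trans K<lam upperˡ)

  open Image ary (α≤κ ↣-∘ upperˡ) U isUltrafilter closed
    (proj₂ (proj₂ (proj₂ (extend X Tails Tails-isFilter Tails-complete))))
  module P = Structure P
  module Q = Structure Q

  P⊨T : P ⊨ T
  P⊨T = Łoś.∏-⊨ closed M M-default (λ x → proj₂ (Diagram.D₀ D (proj₁ x)))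

  Q⊨T : Q ⊨ T
  -- All factors are the same `P`, so the identity serves as default.
  Q⊨T = Łoś.∏-⊨ closed (λ _ → P) (λ _ _ p → p) (λ _ → P⊨T)

  P-model Q-model : Cocone D
  P-model = restrict D P-cocone P⊨T
  Q-model = record
    { apex    = Q , Q⊨T
    ; leg     = λ i → Category._∙_ (Str S) (diagonal P) (leg i)
    ; commute = λ i≤j a → to-cong (diagonal P) (leg-commute i≤j a)
    }

  g : Homomorphism S (proj₁ B.apex) P
  g = B.mediate P-model

  g-equalizes : ∀ b → to germwise (to g b) Q.≈ to (diagonal P) (to g b)
  g-equalizes b =
    -- Both composites equal the mediating map to `Q-model`. Its legs pass through the diagonal, so
    -- `equalize` enters for `germwise`.
    Q.trans {to germwise (to g b)} {to (B.mediate Q-model) b} {to (diagonal P) (to g b)}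
    (B.unique Q-model (Category._∙_ (Str S) germwise g)
      (λ i a → Q.trans {to germwise (to g (to (B.leg i) a))} {to germwise (germ i a)}
                 {to (diagonal P) (germ i a)}
                 (to-cong germwise (B.factor P-model i a)) (equalize i a)) b)
    (Q.sym {to (diagonal P) (to g b)} {to (B.mediate Q-model) b}
      (B.unique Q-model (Category._∙_ (Str S) (diagonal P) g)
        (λ i a → to-cong (diagonal P) (B.factor P-model i a)) b))

  image : ∀ b → Σ[ pt ∈ Point ] germOf pt P.≈ to g b
  image b = equalizer⊆germs (to g b) (g-equalizes b)

  r : Homomorphism S (proj₁ B.apex) A.apex
  r = Category._∙_ (Str S) (value-hom A.cocone) (corestrict g image)

  r-leg : ∀ i a → to r (to (B.leg i) a) A′.≈ to (A.leg i) a
  -- The point chosen for `y` may sit at a stage other than `i`, but it has the germ of `(i , a)`.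
  r-leg i a = value-cong A.cocone {proj₁ (image y)} {i , a}
    (P.trans {germOf (proj₁ (image y))} {to g y} {germ i a}
      (proj₂ (image y)) (B.factor P-model i a))
    where y = to (B.leg i) a

  A⊨T : A.apex ⊨ T
  A⊨T φ φ∈T = Sat-iso (comparison-iso D A B r r-leg) (λ ()) φ (proj₂ B.apex φ φ∈T)
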